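{- Let $d$ be a positive integer and $F$ a Young diagram. There is an explicit bijection between (1) fillings of $F$ that avoid the pattern $d\cdots1(d+1)$ and (2) fillings of $F$ such that for every lattice point $p$ of $F$ the region $\mathrm{Rect}_p$ contains no se-chain of length $d+1$. This bijection preserves every row sum and every column sum, and it commutes with reflection of fillings across the line $y=x$ (i.e., applying the corresponding bijection for the reflected diagram $F'$ to the reflected filling gives the reflection of the image).
   Context: Young diagrams lie in the first quadrant, rows counted from the bottom and columns from the left, cells unit squares with integer vertices (lattice points). For a lattice point $p$, $\mathrm{Rect}_p$ is the rectangle with lower-left corner the origin and upper-right corner $p$. A filling assigns nonnegative integer entries to cells. A se-chain is a sequence of cells with nonzero entries, each strictly below and strictly to the right of the previous; its length is the number of cells. A filling contains $d\cdots1(d+1)$ if there are $d+1$ cells with nonzero entries, the first $d$ forming a se-chain and the last strictly above and strictly to the right of each of the first $d$; otherwise it avoids it. The reflection of a filling of $F$ across $y=x$ is the filling of the reflected Young diagram $F'$ obtained by reflecting the entries. -}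

module Defs where

open import Data.Nat using (ℕ; zero; suc; _<_; _≤_; _>_)
open import Data.Bool using (Bool; true; false)
open import Data.List using (List; length; map; upTo)
open import Data.Nat.ListAction using (sum)
open import Data.List.Relation.Unary.All using (All)
open import Data.List.Relation.Unary.Linked using (Linked)
open import Data.Product using (Σ; ∃; _×_; _,_; proj₁; proj₂)
open import Relation.Binary.PropositionalEquality using (_≡_; _≢_)
open import Relation.Nullary using (¬_)

-- Cells are indexed by (column , row), both starting at 0; the cell (c , r)
-- is the unit square [c, c+1] × [r, r+1] in the first quadrant.
Cell : Set
Cell = ℕ × ℕ

col : Cell → ℕ
col = proj₁

row : Cell → ℕ
row = proj₂

-- A Young diagram (French convention, rows from the bottom, columns from the
-- left): a finite set of cells, closed under moving left and moving down.
record Young : Set where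
  field
    mem       : ℕ → ℕ → Bool
    bound     : ℕ
    bounded   : ∀ c r → mem c r ≡ true → c < bound × r < bound
    leftClosed : ∀ c c' r → c' ≤ c → mem c r ≡ true → mem c' r ≡ true
    downClosed : ∀ c r r' → r' ≤ r → mem c r ≡ true → mem c r' ≡ true
open Young public

reflectY : Young → Young
reflectY F = record
  { mem        = λ c r → mem F r c
  ; bound      = bound F
  ; bounded    = λ c r h → proj₂ (bounded F r c h) , proj₁ (bounded F r c h)
  ; leftClosed = λ c c' r le h → downClosed F r c c' le h
  ; downClosed = λ c r r' le h → leftClosed F r r' c le h
  }

Filling : Young → Set
Filling F = Σ (ℕ → ℕ → ℕ) λ f → ∀ c r → f c r ≢ 0 → mem F c r ≡ true

entry : ∀ {F} → Filling F → Cell → ℕ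
entry T (c , r) = proj₁ T c r

_≈F_ : ∀ {F} → Filling F → Filling F → Set
T ≈F U = ∀ c r → proj₁ T c r ≡ proj₁ U c r

reflectF : ∀ {F} → Filling F → Filling (reflectY F)
reflectF T = (λ c r → proj₁ T r c) , (λ c r h → proj₂ T r c h)

-- Row and column sums (all cells of F lie in columns/rows < bound F).
rowSum : ∀ {F} → Filling F → ℕ → ℕ
rowSum {F} T r = sum (map (λ c → proj₁ T c r) (upTo (bound F)))

colSum : ∀ {F} → Filling F → ℕ → ℕ
colSum {F} T c = sum (map (λ r → proj₁ T c r) (upTo (bound F)))

SE : Cell → Cell → Set
SE a b = col a < col b × row b < row a

NE : Cell → Cell → Set
NE a b = col a < col b × row a < row b

IsSEChain : ∀ {F} → Filling F → List Cell → Set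
IsSEChain {F} T ch = Linked SE ch × All (λ x → entry {F} T x ≢ 0) ch

-- T contains the pattern d⋯1(d+1): d cells forming a se-chain and one more
-- cell with nonzero entry strictly above and strictly right of each of them.
Contains : ∀ {F} → ℕ → Filling F → Set
Contains {F} d T = Σ (List Cell) λ ch → length ch ≡ d × IsSEChain {F} T ch
                 × Σ Cell λ q → entry {F} T q ≢ 0 × All (λ x → NE x q) ch

Avoids : ∀ {F} → ℕ → Filling F → Set
Avoids {F} d T = ¬ Contains {F} d T

-- Lattice points of F: integer points of the closed region covered by F.
LatticePoint : Young → ℕ × ℕ → Set
LatticePoint F (x , y) = Σ ℕ λ c → Σ ℕ λ r →
  mem F c r ≡ true × c ≤ x × x ≤ suc c × r ≤ y × y ≤ suc r

InRect : ℕ × ℕ → Cell → Set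
InRect (x , y) (c , r) = c < x × r < y

RectCond : ∀ {F} → ℕ → Filling F → Set
RectCond {F} d T = ∀ p → LatticePoint F p →
  ¬ (Σ (List Cell) λ ch → length ch ≡ suc d × IsSEChain {F} T ch × All (InRect p) ch)

AvoidSet : ℕ → Young → Set
AvoidSet d F = Σ (Filling F) (Avoids {F} d)

RectSet : ℕ → Young → Set
RectSet d F = Σ (Filling F) (RectCond {F} d)

record Bij {A B : Set} (_≈A_ : A → A → Set) (_≈B_ : B → B → Set) : Set where
  field
    to       : A → B
    from     : B → A
    to-cong  : ∀ {a a'} → a ≈A a' → to a ≈B to a'
    from-cong : ∀ {b b'} → b ≈B b' → from b ≈A from b'
    from∘to  : ∀ a → from (to a) ≈A a
    to∘from  : ∀ b → to (from b) ≈B b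
open Bij public

BijAR : ℕ → Young → Set
BijAR d F = Bij {AvoidSet d F} {RectSet d F}
              (λ a a' → _≈F_ {F} (proj₁ a) (proj₁ a')) (λ b b' → _≈F_ {F} (proj₁ b) (proj₁ b'))

module Submission where

-- Write d = k + 1 and let shapes be sequences with parts 0, …, k.  Both kinds of
-- fillings are encoded by the shapes along the boundary of F, through growth
-- diagrams with two different local rules.  With corner shapes ρ (SW), μ (SE), ν (NW)
-- and κ (NE), both put κᵢ₊₁ = max(μᵢ₊₁,νᵢ₊₁) + min(μᵢ,νᵢ) − ρᵢ and
-- κ₀ = max(μ₀,ν₀) + t.  In the plain rule (RSK) t is the entry e, and a filling stays
-- within d parts iff ρₖ = min(μₖ,νₖ) at all cells of F, which is the condition on Rect_p.
-- In the cyclic rule t = e + min(μₖ,νₖ) − ρₖ; the filling avoids d⋯1(d+1) iff e ≠ 0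
-- forces ρₖ = 0, and then t determines both e and ρₖ.  Growing with one rule and
-- shrinking from the boundary with the other is the bijection; the sizes along the
-- boundary give the row and column sums, and the rules are symmetric in μ and ν.
--
-- Chains are read off the RSK shapes by Viennot's shadow lines: part i+1 is the
-- last-passage function of the shadow of part i, and passing to the shadow shortens
-- the longest se-chain of every Rect_p by one.

open import Defs
open import Data.Bool using (true; false; if_then_else_)
open import Data.Bool.Properties using (¬-not)
open import Data.List using (List; []; _∷_; [_]; _∷ʳ_; _++_; length; map; upTo)
open import Data.List.Properties using (upTo-∷ʳ; map-++)
open import Data.List.Relation.Unary.All using (All; []; _∷_)
open import Data.List.Relation.Unary.Linked using (Linked; []; [-]; _∷_)
open import Data.Nat
open import Data.Nat.ListAction using (sum)
open import Data.Nat.ListAction.Properties using (sum-++)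
open import Data.Nat.Properties
open import Data.Nat.Solver using (module +-*-Solver)
open import Data.Product using (Σ; ∃; _×_; _,_; proj₁; proj₂)
open import Data.Sum using (inj₁; inj₂)
open import Data.Unit using (⊤; tt)
open import Function using (_∘_; flip)
open import Relation.Binary.PropositionalEquality
  using (_≡_; _≢_; refl; sym; trans; cong; cong₂; subst; subst₂; module ≡-Reasoning)
open import Relation.Nullary using (yes; no; does; contradiction)
open import Relation.Nullary.Decidable using (dec-true; dec-false; decidable-stable)

-- Local rules at one cell

-- In a local rule at a cell, m is the smaller of the last parts at the NW and
-- SE corners, r the last part at the SW corner, e the entry of the cell and
-- out m r e the amount added to the first part at the NE corner.
record Rule : Set₁ where
  field
    Valid   : (m r e : ℕ) → Set
    out     : (m r e : ℕ) → ℕ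
    entryOf : (m t : ℕ) → ℕ
    restOf  : (m t : ℕ) → ℕ
    restOf≤     : ∀ m t → restOf m t ≤ m
    valid       : ∀ m t → Valid m (restOf m t) (entryOf m t)
    out-inv     : ∀ m t → out m (restOf m t) (entryOf m t) ≡ t
    entryOf-out : ∀ {m r e} → r ≤ m → Valid m r e → entryOf m (out m r e) ≡ e
    restOf-out  : ∀ {m r e} → r ≤ m → Valid m r e → restOf m (out m r e) ≡ r
    balance     : ∀ {m r e} → r ≤ m → Valid m r e → out m r e + r ≡ e + m
open Rule

plain : Rule
plain = record
  { Valid       = λ m r e → r ≡ m
  ; out         = λ m r e → e
  ; entryOf     = λ m t → t
  ; restOf      = λ m t → m
  ; restOf≤     = λ m t → ≤-refl
  ; valid       = λ m t → refl
  ; out-inv     = λ m t → refl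
  ; entryOf-out = λ _ _ → refl
  ; restOf-out  = λ _ → sym
  ; balance     = λ {m} {r} {e} _ r≡m → cong (e +_) r≡m
  }

-- Validity says that `e` and `r` are never both nonzero, so comparing `t = e + (m ∸ r)` with `m`
-- separates them: if `t ≤ m`, then `e` is 0 and `r` is `m ∸ t`; if `t ≥ m`, then `r` is 0 and `e`
-- is `t ∸ m`.
cyclic : Rule
cyclic = record
  { Valid       = λ m r e → e ≢ 0 → r ≡ 0
  ; out         = λ m r e → e + (m ∸ r)
  ; entryOf     = λ m t → t ∸ m
  ; restOf      = λ m t → m ∸ t
  ; restOf≤     = m∸n≤m
  ; valid       = λ m t e≢0 → m≤n⇒m∸n≡0 (<⇒≤ (m∸n≢0⇒n<m {t} {m} e≢0))
  ; out-inv     = inv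
  ; entryOf-out = entryOf-out′
  ; restOf-out  = restOf-out′
  ; balance     = λ {m} {r} {e} r≤m _ → trans (+-assoc e (m ∸ r) r) (cong (e +_) (m∸n+n≡m r≤m))
  }
  where
  inv : ∀ m t → (t ∸ m) + (m ∸ (m ∸ t)) ≡ t
  inv m t with ≤-total t m
  ... | inj₁ t≤m = cong₂ _+_ (m≤n⇒m∸n≡0 t≤m) (m∸[m∸n]≡n t≤m)
  ... | inj₂ m≤t = trans (cong (λ z → (t ∸ m) + (m ∸ z)) (m≤n⇒m∸n≡0 m≤t)) (m∸n+n≡m m≤t)

  entryOf-out′ : ∀ {m r e} → r ≤ m → (e ≢ 0 → r ≡ 0) → (e + (m ∸ r)) ∸ m ≡ e
  entryOf-out′ {m} {r} {zero} r≤m _ = m≤n⇒m∸n≡0 (m∸n≤m m r)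
  entryOf-out′ {m} {r} {e@(suc _)} r≤m r≡0 rewrite r≡0 (λ ()) = m+n∸n≡m e m

  restOf-out′ : ∀ {m r e} → r ≤ m → (e ≢ 0 → r ≡ 0) → m ∸ (e + (m ∸ r)) ≡ r
  restOf-out′ {m} {r} {zero} r≤m _ = m∸[m∸n]≡n r≤m
  restOf-out′ {m} {r} {e@(suc _)} r≤m r≡0 rewrite r≡0 (λ ()) = m≤n⇒m∸n≡0 (m≤n+m m e)

-- Finite sums

total : ℕ → (ℕ → ℕ) → ℕ
total zero    h = 0
total (suc n) h = total n h + h n

total-cong : ∀ n {g h : ℕ → ℕ} → (∀ {i} → i < n → g i ≡ h i) → total n g ≡ total n h
total-cong zero    eq = refl
total-cong (suc n) eq = cong₂ _+_ (total-cong n (eq ∘ m<n⇒m<1+n)) (eq ≤-refl)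

sum-upTo : ∀ (f : ℕ → ℕ) n → sum (map f (upTo n)) ≡ total n f
sum-upTo f zero    = refl
sum-upTo f (suc n) = begin
  sum (map f (upTo (suc n)))           ≡⟨ cong (sum ∘ map f) (upTo-∷ʳ n) ⟨
  sum (map f (upTo n ∷ʳ n))  ≡⟨ cong sum (map-++ f (upTo n) [ n ]) ⟩
  sum (map f (upTo n) ++ [ f n ]) ≡⟨ sum-++ (map f (upTo n)) [ f n ] ⟩
  sum (map f (upTo n)) + (f n + 0)     ≡⟨ cong₂ _+_ (sum-upTo f n) (+-identityʳ (f n)) ⟩
  total n f + f n                      ∎
  where open ≡-Reasoning

⊔+⊓ : ∀ m n → (m ⊔ n) + (m ⊓ n) ≡ m + n
⊔+⊓ m n with ≤-total m n
... | inj₁ m≤n = trans (cong₂ _+_ (m≤n⇒m⊔n≡n m≤n) (m≤n⇒m⊓n≡m m≤n)) (+-comm n m)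
... | inj₂ n≤m = cong₂ _+_ (m≥n⇒m⊔n≡m n≤m) (m≥n⇒m⊓n≡n n≤m)

-- Shapes and the local step, forward and backward

-- d = suc k throughout, so that parts are indexed by 0, …, k.
module Shapes (k : ℕ) where

  Shape : Set
  Shape = ℕ → ℕ

  infix 4 _≗ₖ_ _⊴_
  _≗ₖ_ : Shape → Shape → Set
  α ≗ₖ β = ∀ {i} → i ≤ k → α i ≡ β i

  -- Interlacing: `β` arises from `α` by adding a horizontal strip. The two bounds keep the
  -- truncated subtractions of the backward step exact.
  record _⊴_ (α β : Shape) : Set where
    field
      sub   : ∀ {i} → i ≤ k → α i ≤ β i
      strip : ∀ {i} → i < k → β (suc i) ≤ α i
  open _⊴_ public

  ⊴-resp : ∀ {α α′ β β′} → α ≗ₖ α′ → β ≗ₖ β′ → α ⊴ β → α′ ⊴ β′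
  ⊴-resp p q s = record
    { sub   = λ i≤k → subst₂ _≤_ (p i≤k) (q i≤k) (sub s i≤k)
    ; strip = λ i<k → subst₂ _≤_ (q i<k) (p (<⇒≤ i<k)) (strip s i<k)
    }

  size : Shape → ℕ
  size = total (suc k)

  -- A relation, because it is solved in both directions: for `κ` by `step`, for `ρ` and `e` by
  -- `back` and `recover`.
  record Local (R : Rule) (κ μ ν ρ : Shape) (e : ℕ) : Set where
    field
      first : κ 0 ≡ (μ 0 ⊔ ν 0) + out R (μ k ⊓ ν k) (ρ k) e
      next  : ∀ {i} → i < k → κ (suc i) ≡ (μ (suc i) ⊔ ν (suc i)) + (μ i ⊓ ν i ∸ ρ i)
      below : ∀ {i} → i ≤ k → ρ i ≤ μ i ⊓ ν i
      ok    : Valid R (μ k ⊓ ν k) (ρ k) e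
  open Local public

  step : Rule → (μ ν ρ : Shape) → ℕ → Shape
  step R μ ν ρ e zero    = (μ 0 ⊔ ν 0) + out R (μ k ⊓ ν k) (ρ k) e
  step R μ ν ρ e (suc i) = (μ (suc i) ⊔ ν (suc i)) + (μ i ⊓ ν i ∸ ρ i)

  -- The surplus of `κ (suc i)` over the maximum equals the deficit of `ρ i` below the minimum. Only
  -- `ρ k` has no such partner; the rule restores it from the surplus of `κ 0`. The `else` branch is
  -- meant for `i = k`.
  back : Rule → (κ μ ν : Shape) → Shape
  back R κ μ ν i =
    if does (i <? k)
    then μ i ⊓ ν i ∸ (κ (suc i) ∸ (μ (suc i) ⊔ ν (suc i)))
    else restOf R (μ i ⊓ ν i) (κ 0 ∸ (μ 0 ⊔ ν 0))

  recover : Rule → (κ μ ν : Shape) → ℕ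
  recover R κ μ ν = entryOf R (μ k ⊓ ν k) (κ 0 ∸ (μ 0 ⊔ ν 0))

  step-cong : ∀ R {μ μ′ ν ν′ ρ ρ′ e e′} → μ ≗ₖ μ′ → ν ≗ₖ ν′ → ρ ≗ₖ ρ′ → e ≡ e′ →
              step R μ ν ρ e ≗ₖ step R μ′ ν′ ρ′ e′
  step-cong R p q r refl {zero} _
    rewrite p {0} z≤n | q {0} z≤n | p {k} ≤-refl | q {k} ≤-refl | r {k} ≤-refl = refl
  step-cong R p q r refl {suc i} i<k
    rewrite p i<k | q i<k | p (<⇒≤ i<k) | q (<⇒≤ i<k) | r (<⇒≤ i<k) = refl

  step-comm : ∀ R μ ν ρ e i → step R μ ν ρ e i ≡ step R ν μ ρ e i
  step-comm R μ ν ρ e zero    rewrite ⊔-comm (μ 0) (ν 0) | ⊓-comm (μ k) (ν k) = refl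
  step-comm R μ ν ρ e (suc i) rewrite ⊔-comm (μ (suc i)) (ν (suc i)) | ⊓-comm (μ i) (ν i) = refl

  Local-comm : ∀ {R κ μ ν ρ e} → Local R κ μ ν ρ e → Local R κ ν μ ρ e
  Local-comm {R} {κ} {μ} {ν} {ρ} {e} L = record
    { first = trans (first L) (step-comm R μ ν ρ e 0)
    ; next  = λ {i} i<k → trans (next L i<k) (step-comm R μ ν ρ e (suc i))
    ; below = λ {i} i≤k → subst (ρ i ≤_) (⊓-comm (μ i) (ν i)) (below L i≤k)
    ; ok    = subst (λ m → Valid R m (ρ k) e) (⊓-comm (μ k) (ν k)) (ok L)
    }

  Local⇒step : ∀ {R κ μ ν ρ e} → Local R κ μ ν ρ e → κ ≗ₖ step R μ ν ρ e
  Local⇒step L {zero}  _   = first L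
  Local⇒step L {suc i} i<k = next L i<k

  back-< : ∀ R κ μ ν {i} → i < k →
           back R κ μ ν i ≡ μ i ⊓ ν i ∸ (κ (suc i) ∸ (μ (suc i) ⊔ ν (suc i)))
  back-< R κ μ ν {i} i<k rewrite dec-true (i <? k) i<k = refl

  back-k : ∀ R κ μ ν → back R κ μ ν k ≡ restOf R (μ k ⊓ ν k) (κ 0 ∸ (μ 0 ⊔ ν 0))
  back-k R κ μ ν rewrite dec-false (k <? k) (<-irrefl refl) = refl

  back≤ : ∀ R κ μ ν i → back R κ μ ν i ≤ μ i ⊓ ν i
  back≤ R κ μ ν i with does (i <? k)
  ... | true  = m∸n≤m (μ i ⊓ ν i) (κ (suc i) ∸ (μ (suc i) ⊔ ν (suc i)))
  ... | false = restOf≤ R (μ i ⊓ ν i) _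

  back-cong : ∀ R {κ κ′ μ μ′ ν ν′} → κ ≗ₖ κ′ → μ ≗ₖ μ′ → ν ≗ₖ ν′ →
              back R κ μ ν ≗ₖ back R κ′ μ′ ν′
  back-cong R {κ} {κ′} {μ} {μ′} {ν} {ν′} p q r {i} i≤k with m≤n⇒m<n∨m≡n i≤k
  ... | inj₁ i<k
    rewrite back-< R κ μ ν i<k | back-< R κ′ μ′ ν′ i<k
          | p i<k | q i<k | r i<k | q i≤k | r i≤k = refl
  ... | inj₂ refl
    rewrite back-k R κ μ ν | back-k R κ′ μ′ ν′
          | p {0} z≤n | q {0} z≤n | r {0} z≤n | q i≤k | r i≤k = refl

  recover-cong : ∀ R {κ κ′ μ μ′ ν ν′} → κ ≗ₖ κ′ → μ ≗ₖ μ′ → ν ≗ₖ ν′ →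
                 recover R κ μ ν ≡ recover R κ′ μ′ ν′
  recover-cong R p q r
    rewrite p {0} z≤n | q {0} z≤n | r {0} z≤n | q {k} ≤-refl | r {k} ≤-refl = refl

  Local⇒back : ∀ {R κ μ ν ρ e} → Local R κ μ ν ρ e → back R κ μ ν ≗ₖ ρ
  Local⇒back {R} {κ} {μ} {ν} {ρ} {e} L {i} i≤k with m≤n⇒m<n∨m≡n i≤k
  ... | inj₁ i<k
    rewrite back-< R κ μ ν i<k | next L i<k
          | m+n∸m≡n (μ (suc i) ⊔ ν (suc i)) (μ i ⊓ ν i ∸ ρ i) = m∸[m∸n]≡n (below L i≤k)
  ... | inj₂ refl
    rewrite back-k R κ μ ν | first L
          | m+n∸m≡n (μ 0 ⊔ ν 0) (out R (μ k ⊓ ν k) (ρ k) e) = restOf-out R (below L i≤k) (ok L)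

  Local⇒recover : ∀ {R κ μ ν ρ e} → Local R κ μ ν ρ e → recover R κ μ ν ≡ e
  Local⇒recover {R} {κ} {μ} {ν} {ρ} {e} L
    rewrite first L | m+n∸m≡n (μ 0 ⊔ ν 0) (out R (μ k ⊓ ν k) (ρ k) e) =
    entryOf-out R (below L ≤-refl) (ok L)

  Local-back : ∀ R {κ μ ν} → μ ⊴ κ → ν ⊴ κ → Local R κ μ ν (back R κ μ ν) (recover R κ μ ν)
  Local-back R {κ} {μ} {ν} s t = record
    { first = sym (trans (cong ((μ 0 ⊔ ν 0) +_) out≡) (m+[n∸m]≡n (⊔-lub (sub s z≤n) (sub t z≤n))))
    ; next  = next′
    ; below = λ {i} _ → back≤ R κ μ ν i
    ; ok    = subst (λ r → Valid R (μ k ⊓ ν k) r (recover R κ μ ν)) (sym (back-k R κ μ ν)) (valid R _ _)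
    }
    where
    out≡ : out R (μ k ⊓ ν k) (back R κ μ ν k) (recover R κ μ ν) ≡ κ 0 ∸ (μ 0 ⊔ ν 0)
    out≡ rewrite back-k R κ μ ν = out-inv R _ _

    next′ : ∀ {i} → i < k →
            κ (suc i) ≡ (μ (suc i) ⊔ ν (suc i)) + (μ i ⊓ ν i ∸ back R κ μ ν i)
    next′ {i} i<k rewrite back-< R κ μ ν i<k
      | m∸[m∸n]≡n {μ i ⊓ ν i} {κ (suc i) ∸ (μ (suc i) ⊔ ν (suc i))}
          (≤-trans (m∸n≤m _ (μ (suc i) ⊔ ν (suc i))) (⊓-glb (strip s i<k) (strip t i<k)))
      = sym (m+[n∸m]≡n (⊔-lub (sub s i<k) (sub t i<k)))

  back-⊴ˡ : ∀ R {κ μ ν} → μ ⊴ κ → ν ⊴ κ → back R κ μ ν ⊴ μ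
  back-⊴ˡ R {κ} {μ} {ν} s t = record
    { sub   = λ {i} _ → ≤-trans (back≤ R κ μ ν i) (m⊓n≤m (μ i) (ν i))
    ; strip = λ {i} i<k → ≤-trans (m≤m⊔n (μ (suc i)) (ν (suc i)))
                (subst (μ (suc i) ⊔ ν (suc i) ≤_) (sym (back-< R κ μ ν i<k)) (bound′ i<k))
    }
    where
    bound′ : ∀ {i} → i < k →
             μ (suc i) ⊔ ν (suc i) ≤ μ i ⊓ ν i ∸ (κ (suc i) ∸ (μ (suc i) ⊔ ν (suc i)))
    -- Subtract the surplus from both sides of `κ (suc i) ≤ μ i ⊓ ν i`; on the left the maximum
    -- remains.
    bound′ {i} i<k = subst (_≤ μ i ⊓ ν i ∸ (κ (suc i) ∸ (μ (suc i) ⊔ ν (suc i))))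
      (m∸[m∸n]≡n (⊔-lub (sub s i<k) (sub t i<k)))
      (∸-monoˡ-≤ (κ (suc i) ∸ (μ (suc i) ⊔ ν (suc i))) (⊓-glb (strip s i<k) (strip t i<k)))

  back-comm : ∀ R κ μ ν i → back R κ μ ν i ≡ back R κ ν μ i
  back-comm R κ μ ν i
    rewrite ⊔-comm (μ 0) (ν 0) | ⊔-comm (μ (suc i)) (ν (suc i)) | ⊓-comm (μ i) (ν i) = refl

  back-⊴ʳ : ∀ R {κ μ ν} → μ ⊴ κ → ν ⊴ κ → back R κ μ ν ⊴ ν
  back-⊴ʳ R {κ} {μ} {ν} s t =
    ⊴-resp (λ {i} _ → back-comm R κ ν μ i) (λ _ → refl) (back-⊴ˡ R t s)

  step-⊴ˡ : ∀ R {μ ν ρ} e → ρ ⊴ μ → ρ ⊴ ν → μ ⊴ step R μ ν ρ e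
  step-⊴ˡ R {μ} {ν} {ρ} e s t = record { sub = sub′ ; strip = strip′ }
    where
    sub′ : ∀ {i} → i ≤ k → μ i ≤ step R μ ν ρ e i
    sub′ {zero}  _ = ≤-trans (m≤m⊔n (μ 0) (ν 0)) (m≤m+n _ _)
    sub′ {suc i} _ = ≤-trans (m≤m⊔n (μ (suc i)) (ν (suc i))) (m≤m+n _ _)

    strip′ : ∀ {i} → i < k → step R μ ν ρ e (suc i) ≤ μ i
    strip′ {i} i<k = begin
      (μ (suc i) ⊔ ν (suc i)) + (μ i ⊓ ν i ∸ ρ i)
        ≤⟨ +-monoˡ-≤ _ (⊔-lub (strip s i<k) (strip t i<k)) ⟩
      ρ i + (μ i ⊓ ν i ∸ ρ i)
        ≡⟨ m+[n∸m]≡n (⊓-glb (sub s (<⇒≤ i<k)) (sub t (<⇒≤ i<k))) ⟩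
      μ i ⊓ ν i
        ≤⟨ m⊓n≤m (μ i) (ν i) ⟩
      μ i ∎
      where open ≤-Reasoning

  step-⊴ʳ : ∀ R {μ ν ρ} e → ρ ⊴ μ → ρ ⊴ ν → ν ⊴ step R μ ν ρ e
  step-⊴ʳ R {μ} {ν} {ρ} e s t =
    ⊴-resp (λ _ → refl) (λ {i} _ → step-comm R ν μ ρ e i) (step-⊴ˡ R e t s)

  step-Local : ∀ R {μ ν ρ} e → ρ ⊴ μ → ρ ⊴ ν → Valid R (μ k ⊓ ν k) (ρ k) e →
               Local R (step R μ ν ρ e) μ ν ρ e
  step-Local R e s t v = record
    { first = refl
    ; next  = λ _ → refl
    ; below = λ i≤k → ⊓-glb (sub s i≤k) (sub t i≤k)
    ; ok    = v
    }

  -- With `μ k ⊓ ν k` added to both sides, every maximum meets the minimum of the same index and the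
  -- sum telescopes. The terms left at the two ends, `out` and `ρ k`, are settled by `balance`.
  Local-size : ∀ {R κ μ ν ρ e} → Local R κ μ ν ρ e → size κ + size ρ ≡ size μ + size ν + e
  Local-size {R} {κ} {μ} {ν} {ρ} {e} L = +-cancelʳ-≡ (μ k ⊓ ν k) _ _ (begin
    total k κ + κ k + (total k ρ + ρ k) + (μ k ⊓ ν k)
      ≡⟨ solve 5 (λ a b c d f → a :+ b :+ (c :+ d) :+ f := a :+ b :+ c :+ f :+ d) refl
           (total k κ) (κ k) (total k ρ) (ρ k) (μ k ⊓ ν k) ⟩
    total k κ + κ k + total k ρ + (μ k ⊓ ν k) + ρ k
      ≡⟨ cong (_+ ρ k) (telescope k ≤-refl) ⟩
    size μ + size ν + out R (μ k ⊓ ν k) (ρ k) e + ρ k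
      ≡⟨ +-assoc (size μ + size ν) _ _ ⟩
    size μ + size ν + (out R (μ k ⊓ ν k) (ρ k) e + ρ k)
      ≡⟨ cong (size μ + size ν +_) (balance R (below L ≤-refl) (ok L)) ⟩
    size μ + size ν + (e + (μ k ⊓ ν k))
      ≡⟨ +-assoc (size μ + size ν) _ _ ⟨
    size μ + size ν + e + (μ k ⊓ ν k) ∎)
    where
    open ≡-Reasoning
    open +-*-Solver using (solve; _:+_; _:=_)
    t = out R (μ k ⊓ ν k) (ρ k) e

    telescope : ∀ j → j ≤ k →
      total (suc j) κ + total j ρ + (μ j ⊓ ν j) ≡ total (suc j) μ + total (suc j) ν + t
    telescope zero _ = begin
      κ 0 + 0 + (μ 0 ⊓ ν 0)              ≡⟨ cong (λ z → z + 0 + (μ 0 ⊓ ν 0)) (first L) ⟩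
      (μ 0 ⊔ ν 0) + t + 0 + (μ 0 ⊓ ν 0)  ≡⟨ solve 3 (λ a b c → a :+ b :+ con 0 :+ c := a :+ c :+ b) refl
                                              (μ 0 ⊔ ν 0) t (μ 0 ⊓ ν 0) ⟩
      (μ 0 ⊔ ν 0) + (μ 0 ⊓ ν 0) + t      ≡⟨ cong (_+ t) (⊔+⊓ (μ 0) (ν 0)) ⟩
      μ 0 + ν 0 + t                      ∎
      where open +-*-Solver using (con)
    telescope (suc j) j<k = begin
      total (suc j) κ + κ (suc j) + (total j ρ + ρ j) + m′
        ≡⟨ cong (λ z → total (suc j) κ + z + (total j ρ + ρ j) + m′) (next L j<k) ⟩
      total (suc j) κ + (M′ + (m ∸ ρ j)) + (total j ρ + ρ j) + m′
        ≡⟨ solve 6 (λ a b c d f g → a :+ (b :+ c) :+ (d :+ f) :+ g := a :+ d :+ (c :+ f) :+ (b :+ g)) refl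
             (total (suc j) κ) M′ (m ∸ ρ j) (total j ρ) (ρ j) m′ ⟩
      total (suc j) κ + total j ρ + ((m ∸ ρ j) + ρ j) + (M′ + m′)
        ≡⟨ cong₂ (λ a b → total (suc j) κ + total j ρ + a + b)
             (m∸n+n≡m (below L (<⇒≤ j<k))) (⊔+⊓ (μ (suc j)) (ν (suc j))) ⟩
      total (suc j) κ + total j ρ + m + (μ (suc j) + ν (suc j))
        ≡⟨ cong (_+ (μ (suc j) + ν (suc j))) (telescope j (<⇒≤ j<k)) ⟩
      total (suc j) μ + total (suc j) ν + t + (μ (suc j) + ν (suc j))
        ≡⟨ solve 5 (λ a b c d f → a :+ b :+ c :+ (d :+ f) := a :+ d :+ (b :+ f) :+ c) refl
             (total (suc j) μ) (total (suc j) ν) t (μ (suc j)) (ν (suc j)) ⟩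
      total (suc (suc j)) μ + total (suc (suc j)) ν + t ∎
      where
      m  = μ j ⊓ ν j
      m′ = μ (suc j) ⊓ ν (suc j)
      M′ = μ (suc j) ⊔ ν (suc j)

  -- Growth from the axes over the whole quadrant

  grow : Rule → (ℕ → ℕ → ℕ) → ℕ → ℕ → Shape
  grow R f zero    y       i = 0
  grow R f (suc x) zero    i = 0
  grow R f (suc x) (suc y)   = step R (grow R f (suc x) y) (grow R f x (suc y)) (grow R f x y) (f x y)

  grow-bottom : ∀ R f x i → grow R f x 0 i ≡ 0
  grow-bottom R f zero    i = refl
  grow-bottom R f (suc x) i = refl

  grow-⊴→ : ∀ R f x y → grow R f x y ⊴ grow R f (suc x) y
  grow-⊴↑ : ∀ R f x y → grow R f x y ⊴ grow R f x (suc y)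
  grow-⊴→ R f zero    zero    = record { sub = λ _ → z≤n ; strip = λ _ → z≤n }
  grow-⊴→ R f (suc x) zero    = record { sub = λ _ → z≤n ; strip = λ _ → z≤n }
  grow-⊴→ R f x       (suc y) = step-⊴ʳ R (f x y) (grow-⊴→ R f x y) (grow-⊴↑ R f x y)
  grow-⊴↑ R f zero    y = record { sub = λ _ → z≤n ; strip = λ _ → z≤n }
  grow-⊴↑ R f (suc x) y = step-⊴ˡ R (f x y) (grow-⊴→ R f x y) (grow-⊴↑ R f x y)

  grow-cong : ∀ R {f g} → (∀ x y → f x y ≡ g x y) → ∀ x y → grow R f x y ≗ₖ grow R g x y
  grow-cong R eq zero    y       _ = refl
  grow-cong R eq (suc x) zero    _ = refl
  grow-cong R eq (suc x) (suc y)   =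
    step-cong R (grow-cong R eq (suc x) y) (grow-cong R eq x (suc y)) (grow-cong R eq x y) (eq x y)

  grow-flip : ∀ R f x y → grow R (flip f) x y ≗ₖ grow R f y x
  grow-flip R f zero    y       {i} _ = sym (grow-bottom R f y i)
  grow-flip R f (suc x) zero    _ = refl
  grow-flip R f (suc x) (suc y) {i} i≤k = trans
    (step-cong R (grow-flip R f (suc x) y) (grow-flip R f x (suc y)) (grow-flip R f x y) refl i≤k)
    (step-comm R (grow R f y (suc x)) (grow R f (suc y) x) (grow R f y x) (f y x) i)

  -- Lattice points of a Young diagram and induction from outside it

  module On (F : Young) where

    N : ℕ
    N = bound F

    -- The lattice points of the closed region of `F`, together with the whole of both axes, where
    -- growth starts from zero.
    Corner : ℕ → ℕ → Set
    Corner zero    y       = ⊤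
    Corner (suc x) zero    = ⊤
    Corner (suc x) (suc y) = mem F x y ≡ true

    corner→ : ∀ {x y} → mem F x y ≡ true → Corner (suc x) y
    corner→ {x} {zero}  m = tt
    corner→ {x} {suc y} m = downClosed F x (suc y) y (n≤1+n y) m

    corner↑ : ∀ {x y} → mem F x y ≡ true → Corner x (suc y)
    corner↑ {zero}  {y} m = tt
    corner↑ {suc x} {y} m = leftClosed F (suc x) x y (n≤1+n x) m

    corner∙ : ∀ {x y} → mem F x y ≡ true → Corner x y
    corner∙ {zero}  {y}     m = tt
    corner∙ {suc x} {zero}  m = tt
    corner∙ {suc x} {suc y} m = corner→ (corner↑ m)

    out→ : ∀ {x y} → mem F x y ≡ false → mem F (suc x) y ≡ false
    out→ {x} {y} o = ¬-not λ m → contradiction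
      (trans (sym (leftClosed F (suc x) x y (n≤1+n x) m)) o) λ ()

    out↑ : ∀ {x y} → mem F x y ≡ false → mem F x (suc y) ≡ false
    out↑ {x} {y} o = ¬-not λ m → contradiction
      (trans (sym (downClosed F x (suc y) y (n≤1+n y) m)) o) λ ()

    Supported : (ℕ → ℕ → ℕ) → Set
    Supported f = ∀ x y → f x y ≢ 0 → mem F x y ≡ true

    unsupported : ∀ {f} → Supported f → ∀ {x y} → mem F x y ≡ false → f x y ≡ 0
    unsupported {f} sup {x} {y} o with f x y in eq
    ... | zero  = refl
    ... | suc n = contradiction (trans (sym (sup x y λ z → contradiction (trans (sym eq) z) λ ())) o) λ ()

    fromOutside : ∀ {ℓ} (P : ℕ → ℕ → Set ℓ) →
      (∀ x y → mem F x y ≡ false → P x y) →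
      (∀ x y → mem F x y ≡ true → P (suc x) (suc y) → P (suc x) y → P x (suc y) → P x y) →
      ∀ x y → P x y
    fromOutside P base ind x y = go (N + N) x y (m≤m+n (N + N) (x + y))
      where
      go : ∀ n x y → N + N ≤ n + (x + y) → P x y
      go n x y le with mem F x y in eq
      go n       x y le | false = base x y eq
      go zero    x y le | true  = contradiction le
        (<⇒≱ (+-mono-< (proj₁ (bounded F x y eq)) (proj₂ (bounded F x y eq))))
      go (suc n) x y le | true  = ind x y eq
        (go n (suc x) (suc y) (≤-trans le (≤-trans (≤-reflexive (sym (+-suc n (x + y))))
          (+-monoʳ-≤ n (s≤s (+-monoʳ-≤ x (n≤1+n y)))))))
        (go n (suc x) y (≤-trans le (≤-reflexive (sym (+-suc n (x + y))))))
        (go n x (suc y) (≤-trans le (≤-reflexive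
          (trans (sym (+-suc n (x + y))) (cong (n +_) (sym (+-suc x y)))))))

    -- Shrinking from the outer boundary

    Shapes² : Set
    Shapes² = ℕ → ℕ → Shape

    -- `a` and `b` stand for `N ∸ x` and `N ∸ y` and make the recursion structural. At a cell of `F`
    -- both are positive, so the first two clauses only meet points outside.
    rev : Rule → Shapes² → (a b : ℕ) → Shapes²
    rev R B zero    b       x y = B x y
    rev R B (suc a) zero    x y = B x y
    rev R B (suc a) (suc b) x y =
      if mem F x y
      then back R (rev R B a b (suc x) (suc y)) (rev R B a (suc b) (suc x) y) (rev R B (suc a) b x (suc y))
      else B x y

    revert : Rule → Shapes² → Shapes²
    revert R B x y = rev R B (N ∸ x) (N ∸ y) x y

    readOff : Rule → Shapes² → ℕ → ℕ → ℕ
    readOff R A x y =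
      if mem F x y then recover R (A (suc x) (suc y)) (A (suc x) y) (A x (suc y)) else 0

    ∸-unfold : ∀ {m} → m < N → N ∸ m ≡ suc (N ∸ suc m)
    ∸-unfold {m} m<N = +-∸-assoc 1 m<N

    revert-in : ∀ R B x y → mem F x y ≡ true →
      revert R B x y ≡ back R (revert R B (suc x) (suc y)) (revert R B (suc x) y) (revert R B x (suc y))
    revert-in R B x y m
      rewrite ∸-unfold (proj₁ (bounded F x y m)) | ∸-unfold (proj₂ (bounded F x y m)) | m = refl

    revert-out : ∀ R B x y → mem F x y ≡ false → revert R B x y ≡ B x y
    revert-out R B x y o with N ∸ x | N ∸ y
    ... | zero  | b     = refl
    ... | suc a | zero  = refl
    ... | suc a | suc b rewrite o = refl

    readOff-in : ∀ R A x y → mem F x y ≡ true →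
      readOff R A x y ≡ recover R (A (suc x) (suc y)) (A (suc x) y) (A x (suc y))
    readOff-in R A x y m rewrite m = refl

    readOff-supported : ∀ R A → Supported (readOff R A)
    readOff-supported R A x y ne with mem F x y
    ... | true  = refl
    ... | false = contradiction refl ne

    Solves : Rule → Shapes² → (ℕ → ℕ → ℕ) → Set
    Solves R A f = ∀ x y → mem F x y ≡ true →
      Local R (A (suc x) (suc y)) (A (suc x) y) (A x (suc y)) (A x y) (f x y)

    -- Interlacing is what backward steps need; the zeros on the axes allow the comparison with
    -- `grow`.
    record Fence (A : Shapes²) : Set where
      field
        bottom : ∀ x {i} → i ≤ k → A x 0 i ≡ 0
        left   : ∀ y {i} → i ≤ k → A 0 y i ≡ 0
        ⊴→     : ∀ x y → A x y ⊴ A (suc x) y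
        ⊴↑     : ∀ x y → A x y ⊴ A x (suc y)
    open Fence

    grow-fence : ∀ R f → Fence (grow R f)
    grow-fence R f = record
      { bottom = λ x {i} _ → grow-bottom R f x i
      ; left   = λ _ _ → refl
      ; ⊴→     = grow-⊴→ R f
      ; ⊴↑     = grow-⊴↑ R f
      }

    -- The condition under which the growth of `f` can be undone. For `cyclic` it amounts to
    -- avoidance of the pattern, for `plain` to the condition on the rectangles.
    Good : Rule → (ℕ → ℕ → ℕ) → Set
    Good R f = ∀ x y → mem F x y ≡ true →
      Valid R (grow R f (suc x) y k ⊓ grow R f x (suc y) k) (grow R f x y k) (f x y)

    grow-solves : ∀ R f → Good R f → Solves R (grow R f) f
    grow-solves R f good x y m =
      step-Local R (f x y) (grow-⊴→ R f x y) (grow-⊴↑ R f x y) (good x y m)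

    solves⇒grow : ∀ {R A f} → Fence A → Solves R A f → ∀ x y → Corner x y → A x y ≗ₖ grow R f x y
    solves⇒grow fe so zero    y       c = left fe y
    solves⇒grow fe so (suc x) zero    c = bottom fe (suc x)
    solves⇒grow {R} fe so (suc x) (suc y) c {i} i≤k = trans (Local⇒step (so x y c) i≤k)
      (step-cong R (solves⇒grow fe so (suc x) y (corner→ c)) (solves⇒grow fe so x (suc y) (corner↑ c))
                   (solves⇒grow fe so x y (corner∙ c)) refl i≤k)

    solves⇒good : ∀ {R A f} → Fence A → Solves R A f → Good R f
    solves⇒good {R} {A} {f} fe so x y m =
      subst₂ (λ a b → Valid R a b (f x y))
        (cong₂ _⊓_ (solves⇒grow fe so (suc x) y (corner→ m) ≤-refl)
                   (solves⇒grow fe so x (suc y) (corner↑ m) ≤-refl))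
        (solves⇒grow fe so x y (corner∙ m) ≤-refl)
        (ok (so x y m))

    revert-⊴ : ∀ R {B} → Fence B → ∀ x y →
      revert R B x y ⊴ revert R B (suc x) y × revert R B x y ⊴ revert R B x (suc y)
    revert-⊴ R {B} fe = fromOutside _ base ind
      where
      base : ∀ x y → mem F x y ≡ false →
        revert R B x y ⊴ revert R B (suc x) y × revert R B x y ⊴ revert R B x (suc y)
      base x y o rewrite revert-out R B x y o | revert-out R B (suc x) y (out→ o)
                       | revert-out R B x (suc y) (out↑ o) = ⊴→ fe x y , ⊴↑ fe x y
      ind : ∀ x y → mem F x y ≡ true → _ → _ → _ → _
      ind x y m _ (_ , s) (t , _) rewrite revert-in R B x y m = back-⊴ˡ R s t , back-⊴ʳ R s t

    -- The zeros on an axis spread inwards from outside `F`: each shape is contained in the next one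
    -- along the axis, which vanishes by induction.
    revert-fence : ∀ R {B} → Fence B → Fence (revert R B)
    revert-fence R {B} fe = record
      { bottom = λ x {i} i≤k → fromOutside (λ x y → y ≡ 0 → revert R B x y i ≡ 0)
          (λ { x .0 o refl → trans (cong (λ α → α i) (revert-out R B x 0 o)) (bottom fe x i≤k) })
          (λ { x .0 m _ right _ refl → n≤0⇒n≡0 (subst (revert R B x 0 i ≤_) (right refl)
                 (sub (proj₁ (revert-⊴ R fe x 0)) i≤k)) })
          x 0 refl
      ; left   = λ y {i} i≤k → fromOutside (λ x y → x ≡ 0 → revert R B x y i ≡ 0)
          (λ { .0 y o refl → trans (cong (λ α → α i) (revert-out R B 0 y o)) (left fe y i≤k) })
          (λ { .0 y m _ _ up refl → n≤0⇒n≡0 (subst (revert R B 0 y i ≤_) (up refl)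
                 (sub (proj₂ (revert-⊴ R fe 0 y)) i≤k)) })
          0 y refl
      ; ⊴→     = λ x y → proj₁ (revert-⊴ R fe x y)
      ; ⊴↑     = λ x y → proj₂ (revert-⊴ R fe x y)
      }

    revert-solves : ∀ R {B} → Fence B → Solves R (revert R B) (readOff R (revert R B))
    revert-solves R {B} fe x y m
      rewrite readOff-in R (revert R B) x y m | revert-in R B x y m =
      Local-back R (proj₂ (revert-⊴ R fe (suc x) y)) (proj₁ (revert-⊴ R fe x (suc y)))

    -- The points compared form the outer boundary of `F`, continued along the axes.
    _≈∂_ : Shapes² → Shapes² → Set
    C ≈∂ D = ∀ x y → Corner x y → mem F x y ≡ false → C x y ≗ₖ D x y

    -- By `Local⇒back` each shape inside `F` is forced by three shapes further out. Congruence,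
    -- inversion and reflection of `transfer` all rest on this.
    revert-unique : ∀ {R B C f} → Solves R C f → B ≈∂ C →
      ∀ x y → Corner x y → revert R B x y ≗ₖ C x y
    revert-unique {R} {B} {C} {f} so eq = fromOutside _ base ind
      where
      base : ∀ x y → mem F x y ≡ false → Corner x y → revert R B x y ≗ₖ C x y
      base x y o c rewrite revert-out R B x y o = eq x y c o
      ind : ∀ x y → mem F x y ≡ true → _ → _ → _ → Corner x y → revert R B x y ≗ₖ C x y
      ind x y m p q r _ {i} i≤k rewrite revert-in R B x y m = trans
        (back-cong R (p m) (q (corner→ m)) (r (corner↑ m)) i≤k)
        (Local⇒back (so x y m) i≤k)

    readOff-unique : ∀ {R B C f} → Supported f → Solves R C f → B ≈∂ C →
      ∀ x y → readOff R (revert R B) x y ≡ f x y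
    readOff-unique {R} {B} sup so eq x y with mem F x y in m
    ... | false = sym (unsupported sup m)
    ... | true  = trans
      (recover-cong R (revert-unique so eq (suc x) (suc y) m)
        (revert-unique so eq (suc x) y (corner→ m)) (revert-unique so eq x (suc y) (corner↑ m)))
      (Local⇒recover (so x y m))

    -- Transfer of fillings from one rule to another

    transfer : Rule → Rule → (ℕ → ℕ → ℕ) → ℕ → ℕ → ℕ
    transfer R S f = readOff S (revert S (grow R f))

    transfer-supported : ∀ R S f → Supported (transfer R S f)
    transfer-supported R S f = readOff-supported S (revert S (grow R f))

    transfer-solves : ∀ R S f → Solves S (revert S (grow R f)) (transfer R S f)
    transfer-solves R S f = revert-solves S (grow-fence R f)

    transfer-good : ∀ R S f → Good S (transfer R S f)
    transfer-good R S f = solves⇒good {A = revert S (grow R f)}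
      (revert-fence S (grow-fence R f)) (transfer-solves R S f)

    transfer-cong : ∀ R S {f g} → (∀ x y → f x y ≡ g x y) →
      ∀ x y → transfer R S f x y ≡ transfer R S g x y
    transfer-cong R S {f} {g} eq = readOff-unique (transfer-supported R S g) (transfer-solves R S g)
      λ x y c o {i} i≤k → trans (grow-cong R eq x y i≤k)
        (cong (λ α → α i) (sym (revert-out S (grow R g) x y o)))

    -- By `solves⇒grow` the `S`-growth of the image is the shrunk family, whose values on the outer
    -- boundary are those of `grow R f`. Shrinking from there by `R` therefore retraces the growth
    -- of `f`.
    transfer-inverse : ∀ R S {f} → Supported f → Good R f →
      ∀ x y → transfer S R (transfer R S f) x y ≡ f x y
    transfer-inverse R S {f} sup good = readOff-unique sup (grow-solves R f good)
      λ x y c o {i} i≤k → trans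
        (sym (solves⇒grow {A = revert S (grow R f)} (revert-fence S (grow-fence R f))
          (transfer-solves R S f) x y c i≤k))
        (cong (λ α → α i) (revert-out S (grow R f) x y o))

    -- Row sums from sizes of shapes

    left-empty : ∀ {A} → Fence A → ∀ y → size (A 0 y) ≡ 0
    left-empty {A} fe y =
      trans (total-cong (suc k) {A 0 y} {λ _ → 0} λ { (s≤s i≤k) → left fe y i≤k }) (zeros (suc k))
      where
      zeros : ∀ n → total n (λ _ → 0) ≡ 0
      zeros zero    = refl
      zeros (suc n) = trans (+-identityʳ _) (zeros n)

    -- Along a row of F the size above exceeds the size below by the entries
    -- passed; to the right of F the shapes of both fillings agree.
    rowTotal-unique : ∀ {R S A B f g} → Supported f → Supported g → Fence A → Fence B →
      Solves R A f → Solves S B g → (∀ x y → mem F x y ≡ false → A x y ≡ B x y) →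
      ∀ y → total N (λ x → f x y) ≡ total N (λ x → g x y)
    rowTotal-unique {R} {S} {A} {B} {f} {g} supf supg feA feB soA soB agree y =
      cancel N (¬-not λ m → <-irrefl refl (proj₁ (bounded F N y m))) (balanced N)
      where
      a↑ a↓ b↑ b↓ rowf rowg : ℕ → ℕ
      a↑ x = size (A x (suc y))
      a↓ x = size (A x y)
      b↑ x = size (B x (suc y))
      b↓ x = size (B x y)
      rowf n = total n (λ x → f x y)
      rowg n = total n (λ x → g x y)

      -- This is `a↑ − a↓ − rowf = b↑ − b↓ − rowg` without subtraction. Comparing the two families
      -- carries it past the end of the row of `F`, where no local rule is assumed.
      Balanced : ℕ → Set
      Balanced n = b↑ n + a↓ n + rowf n ≡ a↑ n + b↓ n + rowg n

      top : ∀ n → mem F n y ≡ false → b↑ n + a↓ n ≡ a↑ n + b↓ n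
      top n o = cong₂ _+_ (cong size (sym (agree n (suc y) (out↑ o)))) (cong size (agree n y o))

      cancel : ∀ n → mem F n y ≡ false → Balanced n → rowf n ≡ rowg n
      cancel n o eq = +-cancelˡ-≡ (b↑ n + a↓ n) _ _ (trans eq (cong (_+ rowg n) (sym (top n o))))

      extend : ∀ n → mem F n y ≡ true → Balanced n → Balanced (suc n)
      extend n m ih = +-cancelʳ-≡ (b↓ n + a↑ n) _ _ (begin
        b↑ (suc n) + a↓ (suc n) + (rowf n + f n y) + (b↓ n + a↑ n)
          ≡⟨ solve 6 (λ p q r s t u → p :+ q :+ (r :+ s) :+ (t :+ u) := (p :+ t) :+ (q :+ u :+ s) :+ r) refl
               (b↑ (suc n)) (a↓ (suc n)) (rowf n) (f n y) (b↓ n) (a↑ n) ⟩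
        (b↑ (suc n) + b↓ n) + (a↓ (suc n) + a↑ n + f n y) + rowf n
          ≡⟨ cong₂ (λ p q → p + q + rowf n) (Local-size (soB n y m)) (sym (Local-size (soA n y m))) ⟩
        (b↓ (suc n) + b↑ n + g n y) + (a↑ (suc n) + a↓ n) + rowf n
          ≡⟨ solve 6 (λ p q r s t u → (p :+ q :+ r) :+ (s :+ t) :+ u := (p :+ r :+ s) :+ (q :+ t :+ u)) refl
               (b↓ (suc n)) (b↑ n) (g n y) (a↑ (suc n)) (a↓ n) (rowf n) ⟩
        (b↓ (suc n) + g n y + a↑ (suc n)) + (b↑ n + a↓ n + rowf n)
          ≡⟨ cong ((b↓ (suc n) + g n y + a↑ (suc n)) +_) ih ⟩
        (b↓ (suc n) + g n y + a↑ (suc n)) + (a↑ n + b↓ n + rowg n)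
          ≡⟨ solve 6 (λ p q r s t u → (p :+ q :+ r) :+ (s :+ t :+ u) := r :+ p :+ (u :+ q) :+ (t :+ s)) refl
               (b↓ (suc n)) (g n y) (a↑ (suc n)) (a↑ n) (b↓ n) (rowg n) ⟩
        a↑ (suc n) + b↓ (suc n) + (rowg n + g n y) + (b↓ n + a↑ n) ∎)
        where
        open ≡-Reasoning
        open +-*-Solver using (solve; _:+_; _:=_)

      skip : ∀ n → mem F n y ≡ false → Balanced n → Balanced (suc n)
      skip n o ih = cong₂ _+_ (top (suc n) (out→ o))
        (cong₂ _+_ (cancel n o ih) (trans (unsupported supf o) (sym (unsupported supg o))))

      balanced : ∀ n → Balanced n
      balanced zero = cong (_+ 0) (cong₂ _+_
        (trans (left-empty feB (suc y)) (sym (left-empty feA (suc y))))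
        (trans (left-empty feA y) (sym (left-empty feB y))))
      balanced (suc n) with mem F n y in eq
      ... | true  = extend n eq (balanced n)
      ... | false = skip n eq (balanced n)

    transfer-rowTotal : ∀ R S {f} → Supported f → Good R f → ∀ y →
      total N (λ x → transfer R S f x y) ≡ total N (λ x → f x y)
    transfer-rowTotal R S {f} sup good = rowTotal-unique
      (transfer-supported R S f) sup (revert-fence S fe) fe
      (transfer-solves R S f) (grow-solves R f good) (revert-out S (grow R f))
      where fe = grow-fence R f

  -- Reflection across the diagonal

  module _ (F : Young) where
    open On F
    module Fᵀ = On (reflectY F)

    good-flip : ∀ R {f} → Good R f → Fᵀ.Good R (flip f)
    good-flip R {f} good x y m = subst₂ (λ a b → Valid R a b (f y x))
      (trans (⊓-comm (grow R f (suc y) x k) _)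
        (sym (cong₂ _⊓_ (grow-flip R f (suc x) y ≤-refl) (grow-flip R f x (suc y) ≤-refl))))
      (sym (grow-flip R f x y ≤-refl))
      (good y x m)

    corner-flip : ∀ x y → Fᵀ.Corner x y → Corner y x
    corner-flip zero    zero    _ = tt
    corner-flip zero    (suc y) _ = tt
    corner-flip (suc x) zero    _ = tt
    corner-flip (suc x) (suc y) c = c

    -- The mirror image of the shrunk family solves the reflected problem, as the rules are
    -- symmetric in `μ` and `ν`, and it has the mirrored boundary values; uniqueness does the rest.
    transfer-flip : ∀ R S f x y → Fᵀ.transfer R S (flip f) x y ≡ transfer R S f y x
    transfer-flip R S f = Fᵀ.readOff-unique
      {C = λ x y → revert S (grow R f) y x}
      (λ x y → transfer-supported R S f y x)
      (λ x y m → Local-comm (transfer-solves R S f y x m))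
      (λ x y c o {i} i≤k → trans (grow-flip R f x y i≤k)
        (cong (λ α → α i) (sym (revert-out S (grow R f) y x o))))

-- Se-chains, last passage and shadow lines

Matrix : Set
Matrix = ℕ → ℕ → ℕ

-- Se-chains of length n of nonzero cells of f in columns x, …, X-1 below height y.
data Chain (f : Matrix) (X : ℕ) : (n x y : ℕ) → Set where
  []  : ∀ {x y} → Chain f X 0 x y
  cell : ∀ {n x y} c r → x ≤ c → c < X → r < y → f c r ≢ 0 →
         Chain f X n (suc c) r → Chain f X (suc n) x y

widen : ∀ {f X n x x′ y y′} → x′ ≤ x → y ≤ y′ → Chain f X n x y → Chain f X n x′ y′
widen p q []                          = []
widen p q (cell c r x≤c c<X r<y ne ch) = cell c r (≤-trans p x≤c) c<X (<-≤-trans r<y q) ne ch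

-- Last-passage recursion: `g x y` is the largest weight in `f` of an up-right path of cells inside
-- the rectangle with upper-right corner `(x , y)`.
record Passage (f g : Matrix) : Set where
  field
    left   : ∀ y → g 0 y ≡ 0
    bottom : ∀ x → g x 0 ≡ 0
    rec    : ∀ x y → g (suc x) (suc y) ≡ (g (suc x) y ⊔ g x (suc y)) + f x y

-- Counts the level lines of `g` with an inner corner at `(x , y)`: the levels above `g x y` that
-- are reached both one step to the right and one step up.
shadow : Matrix → Matrix
shadow g x y = (g (suc x) y ⊓ g x (suc y)) ∸ g x y

shadow-flip : ∀ g x y → shadow (flip g) x y ≡ shadow g y x
shadow-flip g x y = cong (_∸ g y x) (⊓-comm (g y (suc x)) (g (suc y) x))

flip-passage : ∀ {f g} → Passage f g → Passage (flip f) (flip g)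
flip-passage {f} {g} P = record
  { left   = Passage.bottom P
  ; bottom = Passage.left P
  ; rec    = λ x y → trans (Passage.rec P y x) (cong (_+ f y x) (⊔-comm (g (suc y) x) (g y (suc x))))
  }

-- A discrete intermediate value theorem, used to find where a level is first reached along a
-- horizontal line.
crossing : ∀ (p : ℕ → ℕ) h a b → a ≤ b → p a < h → h ≤ p b →
  ∃ λ x → a ≤ x × x < b × p x < h × h ≤ p (suc x)
crossing p h a zero    z≤n lo hi = contradiction hi (<⇒≱ lo)
crossing p h a (suc b) a≤b lo hi with m≤n⇒m<n∨m≡n a≤b
... | inj₂ refl = contradiction hi (<⇒≱ lo)
... | inj₁ (s≤s a≤b′) with h ≤? p b
...   | no  h≰ = b , a≤b′ , ≤-refl , ≰⇒> h≰ , hi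
...   | yes h≤ with crossing p h a b a≤b′ lo h≤
...     | x , a≤x , x<b , l , u = x , a≤x , m<n⇒m<1+n x<b , l , u

module _ {f g : Matrix} (P : Passage f g) where
  open Passage P

  passage-mono→ : ∀ x y → g x y ≤ g (suc x) y
  passage-mono→ x zero    rewrite bottom x = z≤n
  passage-mono→ x (suc y) rewrite rec x y = ≤-trans (m≤n⊔m (g (suc x) y) (g x (suc y))) (m≤m+n _ _)

  passage-mono↑ : ∀ x y → g x y ≤ g x (suc y)
  passage-mono↑ zero    y rewrite left y = z≤n
  passage-mono↑ (suc x) y rewrite rec x y = ≤-trans (m≤m⊔n (g (suc x) y) (g x (suc y))) (m≤m+n _ _)

  passage-monoˡ : ∀ {x x′} y → x ≤ x′ → g x y ≤ g x′ y
  passage-monoˡ {x} y le = go (≤⇒≤′ le)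
    where
    go : ∀ {x′} → x ≤′ x′ → g x y ≤ g x′ y
    go ≤′-refl      = ≤-refl
    go (≤′-step le) = ≤-trans (go le) (passage-mono→ _ y)

  cell<passage : ∀ x y → f x y ≢ 0 → g (suc x) y < g (suc x) (suc y)
  cell<passage x y ne rewrite rec x y = begin-strict
    g (suc x) y                         ≤⟨ m≤m⊔n _ _ ⟩
    g (suc x) y ⊔ g x (suc y)           <⟨ m<m+n _ (n≢0⇒n>0 ne) ⟩
    (g (suc x) y ⊔ g x (suc y)) + f x y ∎
    where open ≤-Reasoning

  -- A level line of g that bends at an inner corner (c , r) runs down the right
  -- side of column c until it meets a nonzero cell.
  cellBelow : ∀ c r h → g c r < h → h ≤ g (suc c) r →
    ∃ λ r′ → r′ < r × f c r′ ≢ 0 × h ≤ g (suc c) (suc r′)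
  cellBelow c zero    h lo hi rewrite bottom (suc c) = contradiction hi (<⇒≱ (≤-<-trans z≤n lo))
  cellBelow c (suc r) h lo hi with f c r ≟ 0
  ... | no  ne = r , ≤-refl , ne , hi
  ... | yes f≡0 with ⊔-sel (g (suc c) r) (g c (suc r))
  ...   | inj₂ eq = contradiction
    (subst (h ≤_) (trans (rec c r) (trans (cong₂ _+_ eq f≡0) (+-identityʳ _))) hi) (<⇒≱ lo)
  ...   | inj₁ eq with cellBelow c r h (≤-<-trans (passage-mono↑ c r) lo)
                     (subst (h ≤_) (trans (rec c r) (trans (cong₂ _+_ eq f≡0) (+-identityʳ _))) hi)
  ...     | r′ , r′<r , ne , u = r′ , m<n⇒m<1+n r′<r , ne , u

  shadow-bounds : ∀ x y → shadow g x y ≢ 0 → g x y < g (suc x) y × g x y < g x (suc y)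
  shadow-bounds x y ne = <-≤-trans lt (m⊓n≤m _ _) , <-≤-trans lt (m⊓n≤n _ _)
    where
    lt : g x y < g (suc x) y ⊓ g x (suc y)
    lt = m∸n≢0⇒n<m ne

  -- Follow the level `g (suc x₀) (suc y₀)` to the right at height `y₀`. It is not yet reached at
  -- `suc x₀` but is at `suc x₁`; where it is crossed, the point one step up has reached it too, so
  -- the level line bends there.
  innerCornerRight : ∀ x₀ y₀ x₁ → x₀ < x₁ → f x₀ y₀ ≢ 0 →
    g (suc x₀) (suc y₀) ≤ g (suc x₁) y₀ → ∃ λ x → x₀ < x × x ≤ x₁ × shadow g x y₀ ≢ 0
  innerCornerRight x₀ y₀ x₁ x₀<x₁ ne le
    with crossing (λ x → g x y₀) (g (suc x₀) (suc y₀)) (suc x₀) (suc x₁) (≤-trans x₀<x₁ (n≤1+n x₁))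
           (cell<passage x₀ y₀ ne) le
  ... | x , x₀<x , s≤s x≤x₁ , lo , hi = x , x₀<x , x≤x₁ ,
    m>n⇒m∸n≢0 (<-≤-trans lo (⊓-glb hi (passage-monoˡ (suc y₀) x₀<x)))

module _ {f g : Matrix} (P : Passage f g) where

  Pᵀ : Passage (flip f) (flip g)
  Pᵀ = flip-passage P

  cellLeft : ∀ c r h → g c r < h → h ≤ g c (suc r) →
    ∃ λ c′ → c′ < c × f c′ r ≢ 0 × h ≤ g (suc c′) (suc r)
  cellLeft c r = cellBelow Pᵀ r c

  -- Take the cell with the smaller passage value at its upper-right corner. Its level is attained
  -- on the way to the other cell: going right from the upper-left cell or, transposed, going up
  -- from the lower-right one.
  innerCorner : ∀ x₀ y₀ x₁ y₁ → x₀ < x₁ → y₁ < y₀ → f x₀ y₀ ≢ 0 → f x₁ y₁ ≢ 0 →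
    ∃ λ x → ∃ λ y → x₀ < x × x ≤ x₁ × y₁ < y × y ≤ y₀ × shadow g x y ≢ 0
  innerCorner x₀ y₀ x₁ y₁ x₀<x₁ y₁<y₀ ne₀ ne₁ with ≤-total (g (suc x₀) (suc y₀)) (g (suc x₁) (suc y₁))
  ... | inj₁ le
    with innerCornerRight P x₀ y₀ x₁ x₀<x₁ ne₀
           (≤-trans le (passage-monoˡ Pᵀ (suc x₁) y₁<y₀))
  ...   | x , lo , hi , ne = x , y₀ , lo , hi , y₁<y₀ , ≤-refl , ne
  innerCorner x₀ y₀ x₁ y₁ x₀<x₁ y₁<y₀ ne₀ ne₁ | inj₂ ge
    with innerCornerRight Pᵀ y₁ x₁ y₀ y₁<y₀ ne₁
           (≤-trans ge (passage-monoˡ P (suc y₀) x₀<x₁))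
  ...   | y , lo , hi , ne = x₁ , y , x₀<x₁ , ≤-refl , lo , hi , λ z → ne (trans (shadow-flip g y x₁) z)

  -- If the level line of the first corner passed below the second one and that of the
  -- second passed left of the first, the two lines would cross.
  cellBetween : ∀ x₀ y₀ x₁ y₁ → x₀ < x₁ → y₁ < y₀ → shadow g x₀ y₀ ≢ 0 → shadow g x₁ y₁ ≢ 0 →
    ∃ λ x → ∃ λ y → x₀ ≤ x × x < x₁ × y₁ ≤ y × y < y₀ × f x y ≢ 0
  cellBetween x₀ y₀ x₁ y₁ x₀<x₁ y₁<y₀ ne₀ ne₁
    with cellBelow P x₀ y₀ _ ≤-refl (proj₁ (shadow-bounds P x₀ y₀ ne₀))
       | cellLeft x₁ y₁ _ ≤-refl (proj₂ (shadow-bounds P x₁ y₁ ne₁))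
  ... | y , y<y₀ , ney , h₀ | x , x<x₁ , nex , h₁ with y₁ ≤? y | x₀ ≤? x
  ...   | yes y₁≤y | _        = x₀ , y , ≤-refl , x₀<x₁ , y₁≤y , y<y₀ , ney
  ...   | no  _    | yes x₀≤x = x , y₁ , x₀≤x , x<x₁ , ≤-refl , y₁<y₀ , nex
  ...   | no  y₁≰y | no  x₀≰x = contradiction (begin-strict
    g x₀ y₀             <⟨ h₀ ⟩
    g (suc x₀) (suc y)  ≤⟨ passage-monoˡ Pᵀ (suc x₀) (≰⇒> y₁≰y) ⟩
    g (suc x₀) y₁       ≤⟨ passage-monoˡ P y₁ x₀<x₁ ⟩
    g x₁ y₁             <⟨ h₁ ⟩
    g (suc x) (suc y₁)  ≤⟨ passage-monoˡ P (suc y₁) (≰⇒> x₀≰x) ⟩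
    g x₀ (suc y₁)       ≤⟨ passage-monoˡ Pᵀ x₀ y₁<y₀ ⟩
    g x₀ y₀             ∎) (<-irrefl refl)
    where open ≤-Reasoning

  -- Cells interleave with corners: one to the left of the first corner, one between any two
  -- neighbours, and one below the last.
  shadowChain⇒chain : ∀ {X n Y} → Chain (shadow g) X (suc n) 0 Y → Chain f X (suc (suc n)) 0 Y
  shadowChain⇒chain {X} (cell c r _ c<X r<Y ne ch)
    with cellLeft c r _ ≤-refl (proj₂ (shadow-bounds P c r ne))
  ... | c′ , c′<c , ne′ , _ =
    cell c′ r z≤n (<-trans c′<c c<X) r<Y ne′ (widen c′<c ≤-refl (go c r c<X ne ch))
    where
    go : ∀ {n} c r → c < X → shadow g c r ≢ 0 → Chain (shadow g) X n (suc c) r → Chain f X (suc n) c r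
    go c r c<X ne [] with cellBelow P c r _ ≤-refl (proj₁ (shadow-bounds P c r ne))
    ... | r′ , r′<r , ne′ , _ = cell c r′ ≤-refl c<X r′<r ne′ []
    go c r c<X ne (cell c₁ r₁ c<c₁ c₁<X r₁<r ne₁ ch)
      with cellBetween c r c₁ r₁ c<c₁ r₁<r ne ne₁
    ... | x , y , c≤x , x<c₁ , r₁≤y , y<r , ne′ =
      cell x y c≤x (<-trans x<c₁ c₁<X) y<r ne′ (widen x<c₁ r₁≤y (go c₁ r₁ c₁<X ne₁ ch))

  chain⇒shadowChain : ∀ {X n Y} → Chain f X (suc n) 0 Y → Chain (shadow g) X n 0 Y
  chain⇒shadowChain {X} (cell c r _ c<X r<Y ne ch) = widen z≤n r<Y (go c r ne ch)
    where
    -- The height bound is `suc r` because the inner corner after the cell `(c , r)` may lie at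
    -- height `r` itself.
    go : ∀ {n} c r → f c r ≢ 0 → Chain f X n (suc c) r → Chain (shadow g) X n (suc c) (suc r)
    go c r ne [] = []
    go c r ne (cell c₁ r₁ c<c₁ c₁<X r₁<r ne₁ ch)
      with innerCorner c r c₁ r₁ c<c₁ r₁<r ne ne₁
    ... | x , y , c<x , x≤c₁ , r₁<y , y≤r , ne′ =
      cell x y c<x (≤-<-trans x≤c₁ c₁<X) (s≤s y≤r) ne′
        (widen (s≤s x≤c₁) r₁<y (go c₁ r₁ ne₁ ch))

  passage≢0⇒chain : ∀ X Y → g X Y ≢ 0 → Chain f X 1 0 Y
  passage≢0⇒chain zero    Y       ne = contradiction (Passage.left P Y) ne
  passage≢0⇒chain (suc x) zero    ne = contradiction (Passage.bottom P (suc x)) ne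
  passage≢0⇒chain (suc x) (suc y) ne with f x y ≟ 0
  ... | no  ne′ = cell x y z≤n ≤-refl ≤-refl ne′ []
  ... | yes f≡0 with ⊔-sel (g (suc x) y) (g x (suc y))
                   | trans (Passage.rec P x y) (trans (cong (_ +_) f≡0) (+-identityʳ _))
  ...   | inj₁ eq | eq′ = widen ≤-refl (n≤1+n y)
    (passage≢0⇒chain (suc x) y (λ z → ne (trans eq′ (trans eq z))))
  ...   | inj₂ eq | eq′ with passage≢0⇒chain x (suc y) (λ z → ne (trans eq′ (trans eq z)))
  ...     | cell c r p q s t [] = cell c r p (m<n⇒m<1+n q) s t []

  chain⇒passage≢0 : ∀ X Y → Chain f X 1 0 Y → g X Y ≢ 0
  chain⇒passage≢0 X Y (cell c r _ c<X r<Y ne []) = n>0⇒n≢0 (begin-strict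
    0                  ≤⟨ z≤n ⟩
    g (suc c) r        <⟨ cell<passage P c r ne ⟩
    g (suc c) (suc r)  ≤⟨ passage-monoˡ P (suc r) c<X ⟩
    g X (suc r)        ≤⟨ passage-monoˡ Pᵀ X r<Y ⟩
    g X Y              ∎)
    where open ≤-Reasoning

-- Se-chains and the last part of the two growths

module Chains (k : ℕ) where
  open Shapes k

  part : Matrix → ℕ → Matrix
  part f i x y = grow plain f x y i

  -- The weights whose last-passage function is part `i`. `source f (suc k)` would feed one further
  -- part; its vanishing on `F` is validity for `plain`.
  source : Matrix → ℕ → Matrix
  source f zero    = f
  source f (suc i) = shadow (part f i)

  part-passage : ∀ f i → Passage (source f i) (part f i)
  part-passage f zero = record
    { left = λ _ → refl ; bottom = λ x → grow-bottom plain f x 0 ; rec = λ _ _ → refl }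
  part-passage f (suc i) = record
    { left = λ _ → refl ; bottom = λ x → grow-bottom plain f x (suc i) ; rec = λ _ _ → refl }

  chain⇒sourceChain : ∀ f i {j X Y} → Chain f X (i + suc j) 0 Y → Chain (source f i) X (suc j) 0 Y
  chain⇒sourceChain f zero    ch = ch
  chain⇒sourceChain f (suc i) {j} {X} {Y} ch = chain⇒shadowChain (part-passage f i)
    (chain⇒sourceChain f i (subst (λ n → Chain f X n 0 Y) (sym (+-suc i (suc j))) ch))

  sourceChain⇒chain : ∀ f i {j X Y} → Chain (source f i) X (suc j) 0 Y → Chain f X (i + suc j) 0 Y
  sourceChain⇒chain f zero    ch = ch
  sourceChain⇒chain f (suc i) {j} {X} {Y} ch = subst (λ n → Chain f X n 0 Y) (+-suc i (suc j))
    (sourceChain⇒chain f i (shadowChain⇒chain (part-passage f i) ch))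

  part≢0⇒chain : ∀ f X Y → part f k X Y ≢ 0 → Chain f X (suc k) 0 Y
  part≢0⇒chain f X Y ne = subst (λ n → Chain f X n 0 Y) (+-comm k 1)
    (sourceChain⇒chain f k (passage≢0⇒chain (part-passage f k) X Y ne))

  chain⇒part≢0 : ∀ f X Y → Chain f X (suc k) 0 Y → part f k X Y ≢ 0
  chain⇒part≢0 f X Y ch = chain⇒passage≢0 (part-passage f k) X Y
    (chain⇒sourceChain f k (subst (λ n → Chain f X n 0 Y) (+-comm 1 k) ch))

  -- As long as the last part vanishes, the cyclic rule has nothing to feed back
  -- into the first part.
  cyclic≗plain-step : ∀ f x y → part f k (suc x) y ⊓ part f k x (suc y) ≡ 0 →
    (∀ {i} → i ≤ k → grow cyclic f (suc x) y i ≡ grow plain f (suc x) y i) →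
    (∀ {i} → i ≤ k → grow cyclic f x (suc y) i ≡ grow plain f x (suc y) i) →
    (∀ {i} → i ≤ k → grow cyclic f x y i ≡ grow plain f x y i) →
    grow cyclic f (suc x) (suc y) ≗ₖ grow plain f (suc x) (suc y)
  cyclic≗plain-step f x y z p q r {i} i≤k = trans (step-cong cyclic p q r refl i≤k) (same i)
    where
    same : ∀ i → step cyclic (grow plain f (suc x) y) (grow plain f x (suc y)) (grow plain f x y) (f x y) i
               ≡ step plain (grow plain f (suc x) y) (grow plain f x (suc y)) (grow plain f x y) (f x y) i
    same zero    = cong (part f 0 (suc x) y ⊔ part f 0 x (suc y) +_) (trans
      (cong (f x y +_) (trans (cong (_∸ part f k x y) z) (0∸n≡0 (part f k x y)))) (+-identityʳ (f x y)))
    same (suc i) = refl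

  -- The last part increases to the right and upwards, so its zero spreads over the whole rectangle,
  -- in which the two growths then never differ.
  part≡0⇒cyclic≗plain : ∀ f x y → part f k x y ≡ 0 → grow cyclic f x y ≗ₖ grow plain f x y
  part≡0⇒cyclic≗plain f zero    y       z _ = refl
  part≡0⇒cyclic≗plain f (suc x) zero    z _ = refl
  part≡0⇒cyclic≗plain f (suc x) (suc y) z {i} i≤k =
    cyclic≗plain-step f x y (cong (_⊓ part f k x (suc y)) z→)
      (part≡0⇒cyclic≗plain f (suc x) y z→) (part≡0⇒cyclic≗plain f x (suc y) z↑)
      (part≡0⇒cyclic≗plain f x y z∙) i≤k
    where
    z→ : part f k (suc x) y ≡ 0
    z→ = n≤0⇒n≡0 (subst (part f k (suc x) y ≤_) z (sub (grow-⊴↑ plain f (suc x) y) ≤-refl))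
    z↑ : part f k x (suc y) ≡ 0
    z↑ = n≤0⇒n≡0 (subst (part f k x (suc y) ≤_) z (sub (grow-⊴→ plain f x (suc y)) ≤-refl))
    z∙ : part f k x y ≡ 0
    z∙ = n≤0⇒n≡0 (subst (part f k x y ≤_) z→ (sub (grow-⊴→ plain f x y) ≤-refl))

  -- The cyclic last part vanishes at the neighbours as well. By induction the plain one vanishes
  -- there too, so the growths agree at the neighbours and, by one more step, at the point itself.
  cyclic≡0⇒part≡0 : ∀ f x y → grow cyclic f x y k ≡ 0 → part f k x y ≡ 0
  cyclic≡0⇒part≡0 f zero    y       z = refl
  cyclic≡0⇒part≡0 f (suc x) zero    z = refl
  cyclic≡0⇒part≡0 f (suc x) (suc y) z =
    trans (sym (cyclic≗plain-step f x y (cong (_⊓ part f k x (suc y)) z→)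
      (part≡0⇒cyclic≗plain f (suc x) y z→) (part≡0⇒cyclic≗plain f x (suc y) z↑)
      (part≡0⇒cyclic≗plain f x y z∙) ≤-refl)) z
    where
    z→ : part f k (suc x) y ≡ 0
    z→ = cyclic≡0⇒part≡0 f (suc x) y (n≤0⇒n≡0
      (subst (grow cyclic f (suc x) y k ≤_) z (sub (grow-⊴↑ cyclic f (suc x) y) ≤-refl)))
    z↑ : part f k x (suc y) ≡ 0
    z↑ = cyclic≡0⇒part≡0 f x (suc y) (n≤0⇒n≡0
      (subst (grow cyclic f x (suc y) k ≤_) z (sub (grow-⊴→ cyclic f x (suc y)) ≤-refl)))
    z∙ : part f k x y ≡ 0
    z∙ = n≤0⇒n≡0 (subst (part f k x y ≤_) z→ (sub (grow-⊴→ plain f x y) ≤-refl))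

  part≡0⇒cyclic≡0 : ∀ f x y → part f k x y ≡ 0 → grow cyclic f x y k ≡ 0
  part≡0⇒cyclic≡0 f x y z = trans (part≡0⇒cyclic≗plain f x y z ≤-refl) z

  -- The two conditions on fillings in terms of validity

  module _ (F : Young) where
    open On F

    fromChain : ∀ (T : Filling F) {X n x y} → Chain (proj₁ T) X n x y →
      Σ (List Cell) λ ch → length ch ≡ n × IsSEChain {F} T ch × All (InRect (X , y)) ch
    fromChain T [] = [] , refl , ([] , []) , []
    fromChain T {X} {y = y} (cell c r _ c<X r<y ne ch) with go c r r<y ch
      where
      go : ∀ {n y} c r → r < y → Chain (proj₁ T) X n (suc c) r →
        Σ (List Cell) λ ch → length ch ≡ n × Linked SE ((c , r) ∷ ch)
          × All (λ x → entry {F} T x ≢ 0) ch × All (InRect (X , y)) ch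
      go c r r<y [] = [] , refl , [-] , [] , []
      go c r r<y (cell c₁ r₁ c<c₁ c₁<X r₁<r ne₁ ch) with go c₁ r₁ (<-trans r₁<r r<y) ch
      ... | cs , len , lk , nz , rect =
        (c₁ , r₁) ∷ cs , cong suc len , (c<c₁ , r₁<r) ∷ lk , ne₁ ∷ nz , (c₁<X , <-trans r₁<r r<y) ∷ rect
    ... | cs , len , lk , nz , rect =
      (c , r) ∷ cs , cong suc len , (lk , ne ∷ nz) , (c<X , r<y) ∷ rect

    toChain : ∀ (T : Filling F) {X Y} ch → IsSEChain {F} T ch → All (InRect (X , Y)) ch →
      Chain (proj₁ T) X (length ch) 0 Y
    toChain T [] _ _ = []
    toChain T {X} (_ ∷ _) (lk , nz) rect@((_ , r<Y) ∷ _) = widen z≤n r<Y (go lk nz rect)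
      where
      go : ∀ {c r ch Y} → Linked SE ((c , r) ∷ ch) → All (λ x → entry {F} T x ≢ 0) ((c , r) ∷ ch) →
        All (InRect (X , Y)) ((c , r) ∷ ch) → Chain (proj₁ T) X (suc (length ch)) c (suc r)
      go [-]            (ne ∷ [])      ((c<X , _) ∷ [])   = cell _ _ ≤-refl c<X ≤-refl ne []
      go ((p , q) ∷ lk) (ne ∷ nz)      ((c<X , _) ∷ rect) =
        cell _ _ ≤-refl c<X ≤-refl ne (widen p q (go lk nz rect))

    -- If the pattern ends in the cell `(x , y)`, its first `suc k` cells form a se-chain inside the
    -- rectangle up to `(x , y)`, and part `k` at that point detects such chains.
    avoids⇒good : ∀ T → Avoids {F} (suc k) T → Good cyclic (proj₁ T)
    avoids⇒good T av x y m ne = part≡0⇒cyclic≡0 (proj₁ T) x y (decidable-stable (_ ≟ 0) λ nz →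
      let cs , len , se , rect = fromChain T (part≢0⇒chain (proj₁ T) x y nz)
      in av (cs , len , se , (x , y) , ne , rect))

    good⇒avoids : ∀ T → Good cyclic (proj₁ T) → Avoids {F} (suc k) T
    good⇒avoids T good (cs , len , se , (x , y) , ne , rect) =
      chain⇒part≢0 (proj₁ T) x y (subst (λ n → Chain (proj₁ T) x n 0 y) len (toChain T cs se rect))
        (cyclic≡0⇒part≡0 (proj₁ T) x y (good x y (proj₂ T x y ne) ne))

    -- A failure of validity at `(x , y)` is a nonzero entry of `source f (suc k)`; this single cell
    -- unfolds into a se-chain of `suc (suc k)` cells of `f`.
    rect⇒good : ∀ T → RectCond {F} (suc k) T → Good plain (proj₁ T)
    rect⇒good T rc x y m = ≤-antisym
      (⊓-glb (sub (grow-⊴→ plain f x y) ≤-refl) (sub (grow-⊴↑ plain f x y) ≤-refl))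
      (m∸n≡0⇒m≤n (decidable-stable (_ ≟ 0) λ nz →
        let cs , len , se , rect = fromChain T (subst (λ n → Chain f (suc x) n 0 (suc y)) (+-comm (suc k) 1)
                                     (sourceChain⇒chain f (suc k) (cell x y z≤n ≤-refl ≤-refl nz [])))
        in rc (suc x , suc y) (x , y , m , n≤1+n x , ≤-refl , n≤1+n y , ≤-refl) (cs , len , se , rect)))
      where f = proj₁ T

    good⇒rect : ∀ T → Good plain (proj₁ T) → RectCond {F} (suc k) T
    good⇒rect T good (X , Y) (c₀ , r₀ , m₀ , _ , X≤ , _ , Y≤) (cs , len , se , rect)
      with chain⇒sourceChain f (suc k) (subst (λ n → Chain f X n 0 Y) (trans len (+-comm 1 (suc k)))
             (toChain T cs se rect))
      where f = proj₁ T
    -- The entry of the filling at `(c , r)` may be zero, so the cell is placed in `F` by means of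
    -- the lattice point.
    ... | cell c r _ c<X r<Y nz [] = nz (m≤n⇒m∸n≡0 (≤-reflexive (sym (good c r
      (leftClosed F c₀ c r (s≤s⁻¹ (≤-trans c<X X≤)) (downClosed F c₀ r₀ r (s≤s⁻¹ (≤-trans r<Y Y≤)) m₀))))))

    -- The bijection and its row and column sums

    send : ∀ R S → Filling F → Filling F
    send R S (f , _) = transfer R S f , transfer-supported R S f

    bijection : BijAR (suc k) F
    bijection = record
      { to        = λ (T , _) → send cyclic plain T ,
                      good⇒rect (send cyclic plain T) (transfer-good cyclic plain (proj₁ T))
      ; from      = λ (T , _) → send plain cyclic T ,
                      good⇒avoids (send plain cyclic T) (transfer-good plain cyclic (proj₁ T))
      ; to-cong   = transfer-cong cyclic plain
      ; from-cong = transfer-cong plain cyclic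
      ; from∘to   = λ (T , av) → transfer-inverse cyclic plain (proj₂ T) (avoids⇒good T av)
      ; to∘from   = λ (T , rc) → transfer-inverse plain cyclic (proj₂ T) (rect⇒good T rc)
      }

    rowSum-preserved : (a : AvoidSet (suc k) F) → ∀ r →
      rowSum {F} (proj₁ (to bijection a)) r ≡ rowSum {F} (proj₁ a) r
    rowSum-preserved (T , av) r = begin
      rowSum {F} (send cyclic plain T) r                     ≡⟨ sum-upTo _ N ⟩
      total N (λ c → transfer cyclic plain (proj₁ T) c r)
        ≡⟨ transfer-rowTotal cyclic plain (proj₂ T) (avoids⇒good T av) r ⟩
      total N (λ c → proj₁ T c r)                            ≡⟨ sum-upTo _ N ⟨
      rowSum {F} T r                                         ∎
      where open ≡-Reasoning

    -- Column sums are row sums of the reflected filling, and transfer commutes with reflection.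
    colSum-preserved : (a : AvoidSet (suc k) F) → ∀ c →
      colSum {F} (proj₁ (to bijection a)) c ≡ colSum {F} (proj₁ a) c
    colSum-preserved (T , av) c = begin
      colSum {F} (send cyclic plain T) c                     ≡⟨ sum-upTo _ N ⟩
      total N (λ r → transfer cyclic plain (proj₁ T) c r)
        ≡⟨ total-cong N (λ {r} _ → transfer-flip F cyclic plain (proj₁ T) r c) ⟨
      total N (λ r → On.transfer (reflectY F) cyclic plain (flip (proj₁ T)) r c)
        ≡⟨ On.transfer-rowTotal (reflectY F) cyclic plain (proj₂ (reflectF {F} T))
             (good-flip F cyclic (avoids⇒good T av)) c ⟩
      total N (λ r → proj₁ T c r)                            ≡⟨ sum-upTo _ N ⟨
      colSum {F} T c                                         ∎
      where open ≡-Reasoning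

theorem9p1 : (d : ℕ) → 1 ≤ d →
    Σ ((F : Young) → BijAR d F) λ Φ →
    (∀ F (a : AvoidSet d F) →
    (∀ r → rowSum {F} (proj₁ (to (Φ F) a)) r ≡ rowSum {F} (proj₁ a) r)
    × (∀ c → colSum {F} (proj₁ (to (Φ F) a)) c ≡ colSum {F} (proj₁ a) c))
    × (∀ F (T : Filling F) (av : Avoids {F} d T) (av' : Avoids {reflectY F} d (reflectF {F} T)) →
    _≈F_ {reflectY F} (proj₁ (to (Φ (reflectY F)) (reflectF {F} T , av')))
    (reflectF {F} (proj₁ (to (Φ F) (T , av)))))
theorem9p1 (suc k) _ =
  bijection ,
  (λ F a → rowSum-preserved F a , colSum-preserved F a) ,
  λ F T _ _ → transfer-flip F cyclic plain (proj₁ T)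
  where
  open Shapes k
  open Chains k
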